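{- Every uncrossable family of cycles in a graph is strongly uncrossable.
   Context: Graphs may be directed or undirected; cycles are simple. For paths/cycles, $P+Q$ denotes the union (multiset sum) of edge sets and $C-P$ the edge set of $C$ minus that of $P$. A family $\mathcal{C}$ of cycles is uncrossable if for all $C_1,C_2\in\mathcal{C}$ and every path $P_2$ in $C_2$ sharing only its two endpoints with $C_1$, there is a path $P_1$ in $C_1$ between these endpoints with $P_1+P_2\in\mathcal{C}$ and such that $(C_1-P_1)+(C_2-P_2)$ contains a cycle of $\mathcal{C}$. The family $\mathcal{C}$ is strongly uncrossable if for all $C_1,C_2\in\mathcal{C}$ and any two vertices $v,w$ lying on both $C_1$ and $C_2$, there are a $v$-$w$-path $P_1$ in $C_1$ and a $v$-$w$-path $P_2$ in $C_2$ (subpaths of the cycles with endpoints $v,w$) such that both $P_1+P_2$ and $(C_1-P_1)+(C_2-P_2)$ contain (the edge set of) a cycle in $\mathcal{C}$. -}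

module Defs where

open import Data.Bool using (if_then_else_)
open import Data.Fin using (Fin)
open import Data.Fin.Subset using (Subset; ⊥; ⁅_⁆; _∪_; _─_; _∈_; _∉_; _⊆_)
open import Data.List using (List; []; _∷_)
open import Data.List.Relation.Unary.Unique.Propositional using (Unique)
open import Data.Nat using (ℕ; _+_; _≤_)
open import Data.Product using (Σ; ∃-syntax; _×_)
open import Data.Sum using (_⊎_)
open import Data.Vec using (lookup)
open import Level using (Level)
open import Relation.Binary.PropositionalEquality using (_≡_; _≢_)
open import Relation.Unary using (Pred)

private
  variable
    ℓ : Level

data Orientation : Set where
  directed undirected : Orientation

-- Finite graphs; parallel edges and loops are allowed.  In an undirected
-- graph the order of the two ends of an edge carries no meaning (see Joins).
record Graph : Set where
  field
    orientation : Orientation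
    #V #E       : ℕ
    src tgt     : Fin #E → Fin #V

  Vertex : Set
  Vertex = Fin #V

  Edge : Set
  Edge = Fin #E

  EdgeSet : Set
  EdgeSet = Subset #E

module _ (G : Graph) where
  open Graph G

  -- e can be traversed from u to v.
  Joins : Edge → Vertex → Vertex → Set
  Joins e u v =
    (src e ≡ u × tgt e ≡ v) ⊎
    (orientation ≡ undirected × src e ≡ v × tgt e ≡ u)

  data Walk : Vertex → Vertex → Set where
    nil  : ∀ {v} → Walk v v
    cons : ∀ {u v w} (e : Edge) → Joins e u v → Walk v w → Walk u w

  edges : ∀ {u v} → Walk u v → List Edge
  edges nil          = []
  edges (cons e _ p) = e ∷ edges p

  vertices : ∀ {u v} → Walk u v → List Vertex
  vertices (nil {v})            = v ∷ []
  vertices (cons {u = u} _ _ p) = u ∷ vertices p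

  -- All vertices except the final one, so that the common end of a closed
  -- walk is listed once.
  departures : ∀ {u v} → Walk u v → List Vertex
  departures nil                  = []
  departures (cons {u = u} _ _ p) = u ∷ departures p

  edgeSet : ∀ {u v} → Walk u v → EdgeSet
  edgeSet nil          = ⊥
  edgeSet (cons e _ p) = ⁅ e ⁆ ∪ edgeSet p

  -- P is the edge set of a simple path from u to v.
  IsPath : Vertex → Vertex → EdgeSet → Set
  IsPath u v P = Σ (Walk u v) λ p → Unique (vertices p) × edgeSet p ≡ P

  -- C is the edge set of a simple cycle (a directed one if G is directed).
  -- Distinctness of edges only matters for undirected closed walks of length
  -- two, where it excludes going back and forth along one edge.
  IsCycle : EdgeSet → Set
  IsCycle C = ∃[ v ] Σ (Walk v v) λ p →
    edges p ≢ [] × Unique (departures p) × Unique (edges p) × edgeSet p ≡ C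

  _LiesOn_ : Vertex → EdgeSet → Set
  v LiesOn F = ∃[ e ] e ∈ F × (src e ≡ v ⊎ tgt e ≡ v)

  -- P is a path in the cycle C with endpoints v and w.  The endpoints are
  -- unordered: in a directed cycle, P may run from v to w or from w to v.
  PathIn : EdgeSet → Vertex → Vertex → EdgeSet → Set
  PathIn C v w P = (IsPath v w P ⊎ IsPath w v P) × P ⊆ C

  EdgeMultiset : Set
  EdgeMultiset = Edge → ℕ

  multiplicity : EdgeSet → EdgeMultiset
  multiplicity F e = if lookup F e then 1 else 0

  infixl 6 _⊕_
  _⊕_ : EdgeSet → EdgeSet → EdgeMultiset
  (P ⊕ Q) e = multiplicity P e + multiplicity Q e

  -- Cycles are identified with their edge sets, so a family of cycles is a
  -- predicate on edge sets all of whose members are cycles.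
  CyclesOnly : Pred EdgeSet ℓ → Set ℓ
  CyclesOnly 𝒞 = ∀ {C} → 𝒞 C → IsCycle C

  Belongs : EdgeMultiset → Pred EdgeSet ℓ → Set ℓ
  Belongs M 𝒞 = ∃[ C ] 𝒞 C × (∀ e → M e ≡ multiplicity C e)

  ContainsMember : EdgeMultiset → Pred EdgeSet ℓ → Set ℓ
  ContainsMember M 𝒞 = ∃[ C ] 𝒞 C × (∀ e → multiplicity C e ≤ M e)

  -- For P a path with endpoints v and w.  The last clause only matters when P
  -- is a single edge, which must then not be an edge of C.
  SharesOnlyEndpoints : EdgeSet → Vertex → Vertex → EdgeSet → Set
  SharesOnlyEndpoints P v w C =
    v LiesOn C × w LiesOn C ×
    (∀ x → x LiesOn P → x LiesOn C → x ≡ v ⊎ x ≡ w) ×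
    (∀ e → e ∈ P → e ∉ C)

  Uncrossable : Pred EdgeSet ℓ → Set ℓ
  Uncrossable 𝒞 =
    ∀ C₁ C₂ → 𝒞 C₁ → 𝒞 C₂ →
    ∀ v w P₂ → v ≢ w → PathIn C₂ v w P₂ → SharesOnlyEndpoints P₂ v w C₁ →
    ∃[ P₁ ] PathIn C₁ v w P₁
          × Belongs (P₁ ⊕ P₂) 𝒞
          × ContainsMember ((C₁ ─ P₁) ⊕ (C₂ ─ P₂)) 𝒞

  StronglyUncrossable : Pred EdgeSet ℓ → Set ℓ
  StronglyUncrossable 𝒞 =
    ∀ C₁ C₂ → 𝒞 C₁ → 𝒞 C₂ →
    ∀ v w → v ≢ w → v LiesOn C₁ → v LiesOn C₂ → w LiesOn C₁ → w LiesOn C₂ →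
    ∃[ P₁ ] ∃[ P₂ ] PathIn C₁ v w P₁ × PathIn C₂ v w P₂
          × ContainsMember (P₁ ⊕ P₂) 𝒞
          × ContainsMember ((C₁ ─ P₁) ⊕ (C₂ ─ P₂)) 𝒞

{-# OPTIONS --safe #-}
module Submission where

-- Let A be an arc of C₁ from s to t, and let Q, R be the arcs of C₂ between s
-- and t.  The key claim (reroute) is that A ∪ Q or A ∪ R contains a member of
-- the family, by induction on the length of A.  If the first edge of A lies
-- on C₂, move s along it.  Otherwise A starts with an ear P from s to some
-- y on C₂, say Q = Q₁Q₂ with y between Q₁ and Q₂.  Uncrossing P yields a member
-- P ∪ Q₁ ⊆ A ∪ Q, or a member P ∪ Q₂ ∪ R; the latter has the arcs Q₂ and P ∪ R
-- between y and t, and the induction hypothesis applies to the rest of A.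
--
-- Hence each of the four arcs of C₁ and C₂ between v and w can be paired with
-- some arc of the other cycle, which forces one of the two perfect matchings
-- between the arcs of C₁ and those of C₂ to consist of good pairs.

open import Defs
open import Relation.Unary using (Pred)

open import Data.Fin.Properties using (_≟_; any?)
open import Data.Bool using (true; false)
open import Data.Fin using (Fin)
open import Data.Fin.Subset using (Subset; _⊆_) renaming (_∈_ to _∈ₛ_; _∉_ to _∉ₛ_; _─_ to _─ₛ_)
open import Data.Fin.Subset.Properties
  using (_∈?_; ∉⊥; x∈⁅x⁆; x∈⁅y⁆⇒x≡y; x∈p∪q⁺; x∈p∪q⁻; x∈p∧x∉q⇒x∈p─q)
open import Data.List using (List; []; _∷_; _++_; _∷ʳ_; [_]; length)
open import Data.List.Membership.Propositional using (_∈_; _∉_)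
open import Data.List.Membership.Propositional.Properties using (∈-++⁺ˡ; ∈-++⁺ʳ; ∈-++⁻)
open import Data.List.Properties using (++-assoc; length-++)
open import Data.List.Relation.Binary.Disjoint.Propositional using (Disjoint)
open import Data.List.Relation.Binary.Permutation.Propositional
  using (_↭_; prep; ↭⇒↭ₛ; ↭-refl; ↭-sym; ↭-trans; ↭-reflexive; module PermutationReasoning)
open import Data.List.Relation.Binary.Permutation.Propositional.Properties
  using (++-comm; ++⁺ˡ; ++⁺ʳ; ∷↭∷ʳ; drop-∷; ∈-resp-↭)
open import Data.List.Relation.Binary.Permutation.Setoid.Properties using (Unique-resp-↭)
open import Data.List.Relation.Unary.All.Properties using (¬Any⇒All¬)
open import Data.List.Relation.Unary.AllPairs using ([]; _∷_)
open import Data.List.Relation.Unary.Any using (here; there)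
open import Data.List.Relation.Unary.Unique.Propositional using (Unique)
open import Data.List.Relation.Unary.Unique.Propositional.Properties
  using (Unique[x∷xs]⇒x∉xs) renaming (++⁺ to Unique-++⁺)
open import Data.Nat using (suc; z≤n; s≤s; _≤_; _+_)
open import Data.Nat.Properties using (≤-refl; ≤-trans; ≤-reflexive; m≤n+m; m+n≡0⇒m≡0; m+n≡0⇒n≡0)
open import Data.Product using (Σ; ∃-syntax; _×_; _,_; proj₁; proj₂) renaming (swap to ×-swap)
open import Data.Sum using (_⊎_; inj₁; inj₂; [_,_]′; swap) renaming (map to ⊎-map)
open import Data.Vec using (lookup)
open import Data.Vec.Properties using ([]=⇒lookup; lookup⇒[]=)
open import Function using (_∘_; id)
open import Relation.Binary.PropositionalEquality
  using (_≡_; _≢_; refl; sym; trans; cong; cong₂; subst; setoid)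
open import Relation.Nullary using (¬_; Dec; yes; no; contradiction)
open import Relation.Nullary.Decidable using (_×-dec_; _⊎-dec_)

-- Lists without repetition.

module _ {A : Set} where

  Unique-↭ : {xs ys : List A} → xs ↭ ys → Unique xs → Unique ys
  Unique-↭ = Unique-resp-↭ (setoid A) ∘ ↭⇒↭ₛ

  Unique-∷ : {x : A} {xs : List A} → x ∉ xs → Unique xs → Unique (x ∷ xs)
  Unique-∷ x∉xs xs! = ¬Any⇒All¬ _ x∉xs ∷ xs!

  Unique-++ʳ : (xs : List A) {ys : List A} → Unique (xs ++ ys) → Unique ys
  Unique-++ʳ []       xs! = xs!
  Unique-++ʳ (_ ∷ xs) (_ ∷ xs!) = Unique-++ʳ xs xs!

  Unique-++ˡ : (xs : List A) {ys : List A} → Unique (xs ++ ys) → Unique xs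
  Unique-++ˡ xs {ys} = Unique-++ʳ ys ∘ Unique-↭ (++-comm xs ys)

  Unique-++-disjoint : (xs : List A) {ys : List A} → Unique (xs ++ ys) → Disjoint xs ys
  Unique-++-disjoint (x ∷ xs) u (here refl , v∈ys) =
    Unique[x∷xs]⇒x∉xs u (∈-++⁺ʳ xs v∈ys)
  Unique-++-disjoint (x ∷ xs) (_ ∷ u) (there v∈xs , v∈ys) =
    Unique-++-disjoint xs u (v∈xs , v∈ys)

-- Members of the family inside a union of two edge lists.

module _ {n ℓ} (𝒞 : Pred (Subset n) ℓ) where

  -- Lists rather than edge sets, because arcs are cut and rejoined as walks and their edge lists
  -- then concatenate. Multiplicities are left out until `containsMember⁺`.
  Spans : List (Fin n) → List (Fin n) → Set ℓ
  Spans xs ys = ∃[ D ] 𝒞 D × (∀ {e} → e ∈ₛ D → e ∈ xs ⊎ e ∈ ys)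

module _ {n ℓ} {𝒞 : Pred (Subset n) ℓ} where

  private
    variable
      xs ys xs′ ys′ : List (Fin n)

  spans-mono : (∀ {e} → e ∈ xs → e ∈ xs′ ⊎ e ∈ ys′) → (∀ {e} → e ∈ ys → e ∈ xs′ ⊎ e ∈ ys′) →
               Spans 𝒞 xs ys → Spans 𝒞 xs′ ys′
  spans-mono f g (D , D∈𝒞 , D⊆) = D , D∈𝒞 , [ f , g ]′ ∘ D⊆

  spans-sym : Spans 𝒞 xs ys → Spans 𝒞 ys xs
  spans-sym = spans-mono inj₂ inj₁

-- Walks, their edges and their vertices.

module _ {G : Graph} where
  open Graph G

  private
    variable
      s t u v w x y : Vertex
      e : Edge

  Simple : Walk G u v → Set
  Simple p = Unique (vertices G p)

  infixr 5 _⟫_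
  _⟫_ : Walk G u v → Walk G v w → Walk G u w
  nil        ⟫ q = q
  cons e j p ⟫ q = cons e j (p ⟫ q)

  edges-⟫ : (p : Walk G u v) (q : Walk G v w) → edges G (p ⟫ q) ≡ edges G p ++ edges G q
  edges-⟫ nil          q = refl
  edges-⟫ (cons e _ p) q = cong (e ∷_) (edges-⟫ p q)

  departures-⟫ : (p : Walk G u v) (q : Walk G v w) →
                 departures G (p ⟫ q) ≡ departures G p ++ departures G q
  departures-⟫ nil          q = refl
  departures-⟫ (cons e _ p) q = cong (_ ∷_) (departures-⟫ p q)

  vertices-∷ʳ : (p : Walk G u v) → vertices G p ≡ departures G p ∷ʳ v
  vertices-∷ʳ nil          = refl
  vertices-∷ʳ (cons e _ p) = cong (_ ∷_) (vertices-∷ʳ p)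

  start∈ : (p : Walk G u v) → u ∈ vertices G p
  start∈ nil          = here refl
  start∈ (cons _ _ _) = here refl

  end∈ : (p : Walk G u v) → v ∈ vertices G p
  end∈ nil          = here refl
  end∈ (cons _ _ p) = there (end∈ p)

  departures⊆vertices : (p : Walk G u v) → x ∈ departures G p → x ∈ vertices G p
  departures⊆vertices p x∈ = subst (_ ∈_) (sym (vertices-∷ʳ p)) (∈-++⁺ˡ x∈)

  start∈departures : u ≢ v → (p : Walk G u v) → u ∈ departures G p
  start∈departures u≢v nil          = contradiction refl u≢v
  start∈departures u≢v (cons _ _ _) = here refl

  vertex-cases : (p : Walk G u v) → x ∈ vertices G p → x ∈ departures G p ⊎ x ≡ v
  vertex-cases p x∈ with ∈-++⁻ (departures G p) (subst (_ ∈_) (vertices-∷ʳ p) x∈)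
  ... | inj₁ x∈p        = inj₁ x∈p
  ... | inj₂ (here x≡v) = inj₂ x≡v

  splitAt : (p : Walk G u v) → x ∈ vertices G p →
            ∃[ p₁ ] Σ (Walk G x v) λ p₂ → p ≡ p₁ ⟫ p₂
  splitAt nil          (here refl) = nil , nil , refl
  splitAt (cons e j p) (here refl) = nil , cons e j p , refl
  splitAt (cons e j p) (there x∈p) with splitAt p x∈p
  ... | p₁ , p₂ , refl = cons e j p₁ , p₂ , refl

  _EndOf_ : Vertex → Edge → Set
  x EndOf e = src e ≡ x ⊎ tgt e ≡ x

  joins-ends : Joins G e u v → x EndOf e → x ≡ u ⊎ x ≡ v
  joins-ends (inj₁ (refl , refl))     = ⊎-map sym sym
  joins-ends (inj₂ (_ , refl , refl)) = swap ∘ ⊎-map sym sym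

  joins-source : Joins G e u v → u EndOf e
  joins-source (inj₁ (eq , _))     = inj₁ eq
  joins-source (inj₂ (_ , _ , eq)) = inj₂ eq

  joins-target : Joins G e u v → v EndOf e
  joins-target (inj₁ (_ , eq))     = inj₂ eq
  joins-target (inj₂ (_ , eq , _)) = inj₁ eq

  -- If the two traversals use `e` in opposite senses, both its ends are `u` and it is a loop.
  joins-unique : Joins G e u v → Joins G e u w → v ≡ w
  joins-unique (inj₁ (refl , refl)) (inj₁ (_ , refl))           = refl
  joins-unique (inj₁ (refl , refl)) (inj₂ (_ , refl , eq))      = eq
  joins-unique (inj₂ (_ , refl , refl)) (inj₁ (eq , refl))      = eq
  joins-unique (inj₂ (_ , refl , refl)) (inj₂ (_ , refl , _))   = refl

  end∈vertices : (p : Walk G u v) → e ∈ edges G p → x EndOf e → x ∈ vertices G p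
  end∈vertices (cons _ j p) (here refl) x∈e with joins-ends j x∈e
  ... | inj₁ refl = here refl
  ... | inj₂ refl = there (start∈ p)
  end∈vertices (cons _ _ p) (there e∈p) x∈e = there (end∈vertices p e∈p x∈e)

  departure-edge : (p : Walk G u v) → x ∈ departures G p →
                   ∃[ e ] e ∈ edges G p × x EndOf e
  departure-edge (cons e j p) (here refl) = e , here refl , joins-source j
  departure-edge (cons e j p) (there x∈p) with departure-edge p x∈p
  ... | f , f∈p , x∈f = f , there f∈p , x∈f

  simple-closed : (p : Walk G v v) → Simple p → p ≡ nil
  simple-closed nil          _ = refl
  simple-closed (cons _ _ p) p! = contradiction (end∈ p) (Unique[x∷xs]⇒x∉xs p!)

  -- A later edge incident with `u` would bring the walk back to its start.
  first-edge : (p : Walk G u w) → Simple p → Joins G e u v → e ∈ edges G p →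
               ∃[ j ] Σ (Walk G v w) λ p′ → p ≡ cons e j p′
  first-edge (cons e k p) p! j (here refl) with joins-unique j k
  ... | refl = k , p , refl
  first-edge (cons _ _ p) p! j (there e∈p) =
    contradiction (end∈vertices p e∈p (joins-source j)) (Unique[x∷xs]⇒x∉xs p!)

  -- This transfers avoidance from vertices to edges: a walk whose departures miss a cycle has no
  -- edge in that cycle.
  edge-departure : (p : Walk G u v) → e ∈ edges G p →
                   ∃[ x ] x ∈ departures G p × x EndOf e
  edge-departure (cons _ j p) (here refl) = _ , here refl , joins-source j
  edge-departure (cons _ j p) (there e∈p) with edge-departure p e∈p
  ... | x , x∈p , x∈e = x , there x∈p , x∈e

  vertices-⟫ : (p : Walk G u v) (q : Walk G v w) →
               vertices G (p ⟫ q) ≡ departures G p ++ vertices G q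
  vertices-⟫ nil          q = refl
  vertices-⟫ (cons _ _ p) q = cong (_ ∷_) (vertices-⟫ p q)

  simple-⟫ʳ : (p : Walk G u v) (q : Walk G v w) → Simple (p ⟫ q) → Simple q
  simple-⟫ʳ p q = Unique-++ʳ (departures G p) ∘ subst Unique (vertices-⟫ p q)

  ∷ʳ-simple : (p : Walk G u v) → Unique (departures G p) → v ∉ departures G p → Simple p
  ∷ʳ-simple p p! v∉p = subst Unique (sym (vertices-∷ʳ p))
    (Unique-++⁺ p! (Unique-∷ (λ ()) []) λ { (v∈p , here refl) → v∉p v∈p })

  end∉departures : (p : Walk G u v) → Simple p → v ∉ departures G p
  end∉departures p p! v∈p =
    Unique-++-disjoint (departures G p) (subst Unique (vertices-∷ʳ p) p!) (v∈p , here refl)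

  simple-⟫ˡ : (p : Walk G u v) (q : Walk G v w) → Simple (p ⟫ q) → Simple p
  simple-⟫ˡ p q pq! = ∷ʳ-simple p (Unique-++ˡ _ pq!′)
      λ v∈p → Unique-++-disjoint (departures G p) pq!′ (v∈p , start∈ q)
    where pq!′ = subst Unique (vertices-⟫ p q) pq!

  edgeSet⁻ : (p : Walk G u v) → e ∈ₛ edgeSet G p → e ∈ edges G p
  edgeSet⁻ nil          e∈ = contradiction e∈ ∉⊥
  edgeSet⁻ (cons f _ p) e∈ with x∈p∪q⁻ _ (edgeSet G p) e∈
  ... | inj₁ e∈f = here (x∈⁅y⁆⇒x≡y f e∈f)
  ... | inj₂ e∈p = there (edgeSet⁻ p e∈p)

  edgeSet⁺ : (p : Walk G u v) → e ∈ edges G p → e ∈ₛ edgeSet G p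
  edgeSet⁺ (cons f _ p) (here refl) = x∈p∪q⁺ (inj₁ (x∈⁅x⁆ f))
  edgeSet⁺ (cons f _ p) (there e∈p) = x∈p∪q⁺ (inj₂ (edgeSet⁺ p e∈p))

  liesOn? : ∀ x F → Dec (_LiesOn_ G x F)
  liesOn? x F = any? λ e → (e ∈? F) ×-dec ((src e ≟ x) ⊎-dec (tgt e ≟ x))

  -- Cycles divided into two arcs.

  -- Both arcs are oriented along the closed walk q ⟫ r, so that moving the two
  -- dividing vertices around the cycle only regroups a cyclic word.
  record Arcs (C : EdgeSet) (q : Walk G s t) (r : Walk G t s) : Set where
    field
      distinct : s ≢ t
      unique   : Unique (departures G q ++ departures G r)
      cover⁻   : e ∈ₛ C → e ∈ edges G q ⊎ e ∈ edges G r
      cover⁺   : e ∈ edges G q ⊎ e ∈ edges G r → e ∈ₛ C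

  open Arcs public

  private
    variable
      C : EdgeSet
      q : Walk G s t
      r : Walk G t s

  rotate : Arcs C q r → Arcs C r q
  rotate {q = q} A .distinct = A .distinct ∘ sym
  rotate {q = q} A .unique   = Unique-↭ (++-comm (departures G q) _) (A .unique)
  rotate A .cover⁻   = swap ∘ A .cover⁻
  rotate A .cover⁺   = A .cover⁺ ∘ swap

  -- The dividing vertex `s` advances to `y`: the closed walks `q₁q₂r` and `q₂rq₁` are rotations of
  -- one another.
  regroup : (q₁ : Walk G s y) (q₂ : Walk G y t) → y ≢ t →
            Arcs C (q₁ ⟫ q₂) r → Arcs C q₂ (r ⟫ q₁)
  regroup q₁ q₂ y≢t A .distinct = y≢t
  regroup {r = r} q₁ q₂ y≢t A .unique = Unique-↭ eq (A .unique)
    where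
    D = departures G
    open PermutationReasoning
    eq : D (q₁ ⟫ q₂) ++ D r ↭ D q₂ ++ D (r ⟫ q₁)
    eq = begin
      D (q₁ ⟫ q₂) ++ D r    ≡⟨ cong (_++ D r) (departures-⟫ q₁ q₂) ⟩
      (D q₁ ++ D q₂) ++ D r ≡⟨ ++-assoc (D q₁) _ _ ⟩
      D q₁ ++ D q₂ ++ D r   ↭⟨ ++-comm (D q₁) _ ⟩
      (D q₂ ++ D r) ++ D q₁ ≡⟨ ++-assoc (D q₂) _ _ ⟩
      D q₂ ++ D r ++ D q₁   ≡⟨ cong (D q₂ ++_) (departures-⟫ r q₁) ⟨
      D q₂ ++ D (r ⟫ q₁)    ∎
  regroup {r = r} q₁ q₂ y≢t A .cover⁻ e∈C with A .cover⁻ e∈C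
  ... | inj₂ e∈r = inj₂ (subst (_ ∈_) (sym (edges-⟫ r q₁)) (∈-++⁺ˡ e∈r))
  ... | inj₁ e∈q with ∈-++⁻ (edges G q₁) (subst (_ ∈_) (edges-⟫ q₁ q₂) e∈q)
  ...   | inj₁ e∈q₁ = inj₂ (subst (_ ∈_) (sym (edges-⟫ r q₁)) (∈-++⁺ʳ (edges G r) e∈q₁))
  ...   | inj₂ e∈q₂ = inj₁ e∈q₂
  regroup {r = r} q₁ q₂ y≢t A .cover⁺ (inj₁ e∈q₂) =
    A .cover⁺ (inj₁ (subst (_ ∈_) (sym (edges-⟫ q₁ q₂)) (∈-++⁺ʳ (edges G q₁) e∈q₂)))
  regroup {r = r} q₁ q₂ y≢t A .cover⁺ (inj₂ e∈)
    with ∈-++⁻ (edges G r) (subst (_ ∈_) (edges-⟫ r q₁) e∈)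
  ... | inj₁ e∈r  = A .cover⁺ (inj₂ e∈r)
  ... | inj₂ e∈q₁ = A .cover⁺ (inj₁ (subst (_ ∈_) (sym (edges-⟫ q₁ q₂)) (∈-++⁺ˡ e∈q₁)))

  arc-simple : {q : Walk G s t} {r : Walk G t s} → Arcs C q r → Simple q
  arc-simple {q = q} {r} A = ∷ʳ-simple q (Unique-++ˡ _ (A .unique)) λ t∈q →
    Unique-++-disjoint (departures G q) (A .unique)
      (t∈q , start∈departures (A .distinct ∘ sym) r)

  on-arc : {q : Walk G s t} {r : Walk G t s} → Arcs C q r → _LiesOn_ G x C →
           x ∈ vertices G q ⊎ x ∈ vertices G r
  on-arc {q = q} {r} A (e , e∈C , x∈e) =
    ⊎-map (λ e∈ → end∈vertices q e∈ x∈e) (λ e∈ → end∈vertices r e∈ x∈e) (A .cover⁻ e∈C)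

  liesOn-arc : {q : Walk G s t} {r : Walk G t s} → Arcs C q r →
               x ∈ departures G q ++ departures G r → _LiesOn_ G x C
  liesOn-arc {q = q} {r} A x∈ with ∈-++⁻ (departures G q) x∈
  ... | inj₁ x∈q with departure-edge q x∈q
  ...   | e , e∈q , x∈e = e , A .cover⁺ (inj₁ e∈q) , x∈e
  liesOn-arc {q = q} {r} A x∈ | inj₂ x∈r with departure-edge r x∈r
  ...   | e , e∈r , x∈e = e , A .cover⁺ (inj₂ e∈r) , x∈e

  -- A common departure of `p` and `r` lies on `C`, so it could only be `s` or `t`. But `s` is a
  -- departure of `q`, hence not of `r`, and `t` is the end of the simple walk `p`.
  replace-arc : ∀ {C′} {q : Walk G s t} {r : Walk G t s} (p : Walk G s t) → Arcs C q r → Simple p →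
                (∀ {x} → x ∈ vertices G p → _LiesOn_ G x C → x ≡ s ⊎ x ≡ t) →
                (∀ {e} → e ∈ₛ C′ → e ∈ edges G p ⊎ e ∈ edges G r) →
                (∀ {e} → e ∈ edges G p ⊎ e ∈ edges G r → e ∈ₛ C′) →
                Arcs C′ p r
  replace-arc p A p! p∩C c⁻ c⁺ .distinct = A .distinct
  replace-arc {q = q} {r} p A p! p∩C c⁻ c⁺ .unique =
    Unique-++⁺ (Unique-++ˡ _ (subst Unique (vertices-∷ʳ p) p!))
               (Unique-++ʳ (departures G q) (A .unique)) disjoint
    where
    disjoint : Disjoint (departures G p) (departures G r)
    disjoint (x∈p , x∈r)
      with p∩C (departures⊆vertices p x∈p) (liesOn-arc A (∈-++⁺ʳ (departures G q) x∈r))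
    ... | inj₁ refl = Unique-++-disjoint (departures G q) (A .unique)
                        (start∈departures (A .distinct) q , x∈r)
    ... | inj₂ refl = end∉departures p p! x∈p
  replace-arc p A p! p∩C c⁻ c⁺ .cover⁻ = c⁻
  replace-arc p A p! p∩C c⁻ c⁺ .cover⁺ = c⁺

  -- Supplies the ears: stopping at the first vertex on `F` keeps all earlier ones off `F`. The
  -- start may be on `F` already, and then `p` is empty.
  firstHit : ∀ F (a : Walk G u t) → _LiesOn_ G t F →
             ∃[ y ] Σ (Walk G u y) λ p → Σ (Walk G y t) λ a′ →
               a ≡ p ⟫ a′ × _LiesOn_ G y F × (∀ {x} → x ∈ departures G p → ¬ _LiesOn_ G x F)
  firstHit F nil t∈F = _ , nil , nil , refl , t∈F , λ ()
  firstHit {u} F (cons e j a) t∈F with liesOn? u F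
  ... | yes u∈F = u , nil , cons e j a , refl , u∈F , λ ()
  ... | no  u∉F with firstHit F a t∈F
  ...   | y , p , a′ , refl , y∈F , off =
          y , cons e j p , a′ , refl , y∈F , λ { (here refl) → u∉F ; (there x∈p) → off x∈p }

-- From edge multisets to membership and back.

module _ {G : Graph} where
  open Graph G

  private
    variable
      e : Edge
      P Q : EdgeSet

  ∈⇒multiplicity : e ∈ₛ P → multiplicity G P e ≡ 1
  ∈⇒multiplicity e∈P rewrite []=⇒lookup e∈P = refl

  ∉⇒multiplicity : e ∉ₛ P → multiplicity G P e ≡ 0
  ∉⇒multiplicity {e} {P} e∉P with lookup P e in eq
  ... | true  = contradiction (lookup⇒[]= e P eq) e∉P
  ... | false = refl

  module _ {ℓ} {𝒞 : Pred EdgeSet ℓ} where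

    -- An edge has nonzero count in the sum exactly when it lies in `P` or `Q`, so comparing
    -- supports gives both inclusions.
    belongs⁻ : Belongs G (_⊕_ G P Q) 𝒞 →
               ∃[ C ] 𝒞 C × (∀ {e} → e ∈ₛ C → e ∈ₛ P ⊎ e ∈ₛ Q) × (∀ {e} → e ∈ₛ P ⊎ e ∈ₛ Q → e ∈ₛ C)
    belongs⁻ {P} {Q} (C , C∈𝒞 , eq) = C , C∈𝒞 , to , from
      where
      to : ∀ {e} → e ∈ₛ C → e ∈ₛ P ⊎ e ∈ₛ Q
      to {e} e∈C with e ∈? P | e ∈? Q
      ... | yes e∈P | _       = inj₁ e∈P
      ... | _       | yes e∈Q = inj₂ e∈Q
      ... | no  e∉P | no  e∉Q with trans (sym (cong₂ _+_ (∉⇒multiplicity e∉P) (∉⇒multiplicity e∉Q)))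
                                        (trans (eq e) (∈⇒multiplicity e∈C))
      ...   | ()
      from : ∀ {e} → e ∈ₛ P ⊎ e ∈ₛ Q → e ∈ₛ C
      from {e} e∈ with e ∈? C
      ... | yes e∈C = e∈C
      ... | no  e∉C with trans (eq e) (∉⇒multiplicity e∉C) | e∈
      ...   | m≡0 | inj₁ e∈P with trans (sym (∈⇒multiplicity e∈P)) (m+n≡0⇒m≡0 _ m≡0)
      ...     | ()
      from {e} e∈ | no e∉C | m≡0 | inj₂ e∈Q
        with trans (sym (∈⇒multiplicity e∈Q)) (m+n≡0⇒n≡0 (multiplicity G P e) m≡0)
      ... | ()

    -- Each edge counts at most once in `C`, so lying in one summand already gives the bound.
    containsMember⁺ : (∃[ C ] 𝒞 C × (∀ {e} → e ∈ₛ C → e ∈ₛ P ⊎ e ∈ₛ Q)) →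
                      ContainsMember G (_⊕_ G P Q) 𝒞
    containsMember⁺ {P} {Q} (C , C∈𝒞 , C⊆) = C , C∈𝒞 , bound
      where
      bound : ∀ e → multiplicity G C e ≤ multiplicity G P e + multiplicity G Q e
      bound e with e ∈? C
      ... | no  e∉C rewrite ∉⇒multiplicity e∉C = z≤n
      ... | yes e∈C rewrite ∈⇒multiplicity e∈C with C⊆ e∈C
      ...   | inj₁ e∈P rewrite ∈⇒multiplicity e∈P = s≤s z≤n
      ...   | inj₂ e∈Q rewrite ∈⇒multiplicity e∈Q = m≤n+m 1 _

-- The underlying undirected graph.

module _ (G : Graph) where

  -- In a directed graph, uncrossing may return a path of either direction, so
  -- arcs of cycles are compared as undirected walks.
  underlying : Graph
  underlying = record G { orientation = undirected }

  module _ {u v : Graph.Vertex G} where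

    joins-underlying : ∀ {e} → Joins G e u v → Joins underlying e u v
    joins-underlying (inj₁ j)       = inj₁ j
    joins-underlying (inj₂ (_ , j)) = inj₂ (refl , j)

    joins-sym : ∀ {e} → Joins underlying e u v → Joins underlying e v u
    joins-sym (inj₁ (eq , eq′))     = inj₂ (refl , eq , eq′)
    joins-sym (inj₂ (_ , eq , eq′)) = inj₁ (eq , eq′)

module _ {G : Graph} where
  open Graph G

  private
    H = underlying G
    variable
      s t u v w x y : Vertex
      e : Edge
      C : EdgeSet

  forget : Walk G u v → Walk H u v
  forget nil          = nil
  forget (cons e j p) = cons e (joins-underlying G j) (forget p)

  edges-forget : (p : Walk G u v) → edges H (forget p) ≡ edges G p
  edges-forget nil          = refl
  edges-forget (cons e _ p) = cong (e ∷_) (edges-forget p)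

  departures-forget : (p : Walk G u v) → departures H (forget p) ≡ departures G p
  departures-forget nil          = refl
  departures-forget (cons _ _ p) = cong (_ ∷_) (departures-forget p)

  vertices-forget : (p : Walk G u v) → vertices H (forget p) ≡ vertices G p
  vertices-forget nil          = refl
  vertices-forget (cons _ _ p) = cong (_ ∷_) (vertices-forget p)

  arcs-forget : (q : Walk G s t) (r : Walk G t s) → Arcs C q r → Arcs C (forget q) (forget r)
  arcs-forget q r A .distinct = A .distinct
  arcs-forget q r A .unique =
    subst Unique (sym (cong₂ _++_ (departures-forget q) (departures-forget r))) (A .unique)
  arcs-forget q r A .cover⁻ =
    ⊎-map (subst (_ ∈_) (sym (edges-forget q))) (subst (_ ∈_) (sym (edges-forget r))) ∘ A .cover⁻
  arcs-forget q r A .cover⁺ =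
    A .cover⁺ ∘ ⊎-map (subst (_ ∈_) (edges-forget q)) (subst (_ ∈_) (edges-forget r))

  -- Reversal of walks and arcs.

  reverse : Walk H u v → Walk H v u
  reverse nil          = nil
  reverse (cons e j p) = reverse p ⟫ cons e (joins-sym G j) nil

  edges-reverse : (p : Walk H u v) → edges H (reverse p) ↭ edges H p
  edges-reverse nil          = ↭-refl
  edges-reverse (cons e j p) = begin
    edges H (reverse p ⟫ cons e _ nil) ≡⟨ edges-⟫ (reverse p) _ ⟩
    edges H (reverse p) ∷ʳ e           ↭⟨ ∷↭∷ʳ e _ ⟨
    e ∷ edges H (reverse p)            ↭⟨ prep e (edges-reverse p) ⟩
    e ∷ edges H p                      ∎
    where open PermutationReasoning

  vertices-reverse : (p : Walk H u v) → vertices H (reverse p) ↭ vertices H p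
  vertices-reverse nil = ↭-refl
  vertices-reverse {u} (cons {v = v} e j p) = begin
    vertices H (reverse p ⟫ last)              ≡⟨ vertices-∷ʳ (reverse p ⟫ last) ⟩
    departures H (reverse p ⟫ last) ∷ʳ u       ≡⟨ cong (_∷ʳ u) (departures-⟫ (reverse p) last) ⟩
    (departures H (reverse p) ∷ʳ v) ∷ʳ u       ≡⟨ cong (_∷ʳ u) (vertices-∷ʳ (reverse p)) ⟨
    vertices H (reverse p) ∷ʳ u                ↭⟨ ∷↭∷ʳ u _ ⟨
    u ∷ vertices H (reverse p)                 ↭⟨ prep u (vertices-reverse p) ⟩
    u ∷ vertices H p                           ∎
    where
    open PermutationReasoning
    last = cons e (joins-sym G j) nil

  -- Reversal makes `v` a departure and `u` the end, so the lists agree up to order only once the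
  -- end is appended.
  departures-reverse : (p : Walk H u v) → departures H (reverse p) ∷ʳ u ↭ departures H p ∷ʳ v
  departures-reverse p = begin
    departures H (reverse p) ∷ʳ _ ≡⟨ vertices-∷ʳ (reverse p) ⟨
    vertices H (reverse p)        ↭⟨ vertices-reverse p ⟩
    vertices H p                  ≡⟨ vertices-∷ʳ p ⟩
    departures H p ∷ʳ _           ∎
    where open PermutationReasoning

  simple-reverse : (p : Walk H u v) → Simple p → Simple (reverse p)
  simple-reverse p = Unique-↭ (↭-sym (vertices-reverse p))

  -- The same cycle traversed backwards, still divided at `s` and `t`. An argument for an edge or
  -- vertex on the first arc thereby covers the second arc too.
  reflect : {q : Walk H s t} {r : Walk H t s} → Arcs C q r → Arcs C (reverse r) (reverse q)
  reflect A .distinct = A .distinct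
  reflect {s} {t} {q = q} {r} A .unique = Unique-↭ (↭-sym (drop-∷ eq)) (A .unique)
    where
    D = departures H
    open PermutationReasoning
    -- The extra `s` is traded for `t` when the reversal of `q` is undone, and `t` for `s` when that
    -- of `r` is; then it cancels.
    eq : s ∷ D (reverse r) ++ D (reverse q) ↭ s ∷ D q ++ D r
    eq = begin
      s ∷ D (reverse r) ++ D (reverse q)  ↭⟨ ∷↭∷ʳ s _ ⟩
      (D (reverse r) ++ D (reverse q)) ∷ʳ s ≡⟨ ++-assoc (D (reverse r)) _ _ ⟩
      D (reverse r) ++ (D (reverse q) ∷ʳ s) ↭⟨ ++⁺ˡ (D (reverse r)) (departures-reverse q) ⟩
      D (reverse r) ++ (D q ∷ʳ t)           ↭⟨ ++⁺ˡ (D (reverse r)) (++-comm (D q) _) ⟩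
      D (reverse r) ++ (t ∷ D q)            ≡⟨ ++-assoc (D (reverse r)) [ t ] _ ⟨
      (D (reverse r) ∷ʳ t) ++ D q           ↭⟨ ++⁺ʳ (D q) (departures-reverse r) ⟩
      (D r ∷ʳ s) ++ D q                     ↭⟨ ++-comm (D r ∷ʳ s) _ ⟩
      D q ++ D r ∷ʳ s                       ≡⟨ ++-assoc (D q) _ _ ⟨
      (D q ++ D r) ∷ʳ s                     ↭⟨ ∷↭∷ʳ s _ ⟨
      s ∷ D q ++ D r                        ∎
  reflect {q = q} {r} A .cover⁻ e∈C =
    swap (⊎-map (∈-resp-↭ (↭-sym (edges-reverse q))) (∈-resp-↭ (↭-sym (edges-reverse r)))
      (A .cover⁻ e∈C))
  reflect {q = q} {r} A .cover⁺ =
    A .cover⁺ ∘ ⊎-map (∈-resp-↭ (edges-reverse q)) (∈-resp-↭ (edges-reverse r)) ∘ swap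

  -- Paths inside a cycle.

  infix 4 _≐_
  -- The endpoints may differ because a path from `s` to `t` is also compared with an arc from `t`
  -- to `s`.
  _≐_ : Walk H u v → Walk H x y → Set
  p ≐ q = ∀ e → (e ∈ edges H p → e ∈ edges H q) × (e ∈ edges H q → e ∈ edges H p)

  ≐-reverse : (p : Walk H u v) (q : Walk H x y) → p ≐ reverse q → p ≐ q
  ≐-reverse p q eq e = ∈-resp-↭ (edges-reverse q) ∘ proj₁ (eq e) ,
                       proj₂ (eq e) ∘ ∈-resp-↭ (↭-sym (edges-reverse q))

  ≐-cons : ∀ {z} {p : Walk H v w} {q : Walk H x y}
           (j : Joins H e u v) (k : Joins H e z x) → p ≐ q → cons e j p ≐ cons {w = y} e k q
  ≐-cons j k eq e = (λ { (here e≡) → here e≡ ; (there e∈) → there (proj₁ (eq e) e∈) }) ,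
                    (λ { (here e≡) → here e≡ ; (there e∈) → there (proj₂ (eq e) e∈) })

  -- Induction along `p`: its first edge lies on `C`, so it starts one of the two arcs as seen from
  -- `s`. Moving the dividing vertex across that edge leaves a shorter path in the same cycle.
  arc-dichotomy : (p : Walk H s t) → Simple p → (∀ {e} → e ∈ edges H p → e ∈ₛ C) →
                  (q : Walk H s t) (r : Walk H t s) → Arcs C q r → p ≐ q ⊎ p ≐ r
  arc-dichotomy nil _ _ q r A = contradiction refl (A .distinct)
  arc-dichotomy {s} {t} {C} (cons {v = s′} e j p) p!@(_ ∷ p!′) p⊆C q r A =
    [ along q r A
    -- An edge of `r` is on the first arc after `reflect`; the two alternatives are then exchanged
    -- back.
    , (λ e∈r → swap (⊎-map (≐-reverse (cons e j p) r) (≐-reverse (cons e j p) q)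
        (along (reverse r) (reverse q) (reflect A) (∈-resp-↭ (↭-sym (edges-reverse r)) e∈r))))
    ]′ (A .cover⁻ (p⊆C (here refl)))
    where
    along : (q : Walk H s t) (r : Walk H t s) → Arcs C q r → e ∈ edges H q →
            cons e j p ≐ q ⊎ cons e j p ≐ r
    along q r A e∈q with first-edge q (arc-simple A) j e∈q
    ... | k , q′ , refl with s′ ≟ t
    -- One edge reaches `t`: both remainders are simple closed walks and hence empty.
    ...   | yes refl rewrite simple-closed p p!′
                           | simple-closed q′ (Unique-++ʳ [ s ] (arc-simple A)) =
            inj₁ λ _ → id , id
    ...   | no s′≢t with arc-dichotomy p p!′ (p⊆C ∘ there) q′ (r ⟫ cons e k nil)
                           (regroup (cons e k nil) q′ s′≢t A)
    ...     | inj₁ p≐q′ = inj₁ (≐-cons j k p≐q′)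
    -- The remainder cannot match the arc containing `e`, because `p` would then return to `s`.
    ...     | inj₂ p≐r  = contradiction
                (end∈vertices p
                  (proj₂ (p≐r e) (subst (e ∈_) (sym (edges-⟫ r _)) (∈-++⁺ʳ (edges H r) (here refl))))
                  (joins-source {G = H} j))
                (Unique[x∷xs]⇒x∉xs p!)

  -- Makes the path returned by uncrossing, whichever way it runs, comparable with arcs from `s` to
  -- `y`.
  undirectedPath : ∀ {P} → IsPath G s y P ⊎ IsPath G y s P →
    Σ (Walk H s y) λ p → Simple p × (∀ {e} → e ∈ edges H p → e ∈ₛ P)
                                  × (∀ {e} → e ∈ₛ P → e ∈ edges H p)
  undirectedPath (inj₁ (q , q! , refl)) =
    forget q , subst Unique (sym (vertices-forget q)) q! ,
    edgeSet⁺ q ∘ subst (_ ∈_) (edges-forget q) ,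
    subst (_ ∈_) (sym (edges-forget q)) ∘ edgeSet⁻ q
  undirectedPath (inj₂ (q , q! , refl)) =
    reverse (forget q) , simple-reverse (forget q) (subst Unique (sym (vertices-forget q)) q!) ,
    edgeSet⁺ q ∘ subst (_ ∈_) (edges-forget q) ∘ ∈-resp-↭ (edges-reverse (forget q)) ,
    ∈-resp-↭ (↭-sym (edges-reverse (forget q))) ∘ subst (_ ∈_) (sym (edges-forget q)) ∘ edgeSet⁻ q

  -- Rerouting an arc through another member.

  module _ {ℓ} {𝒞 : Pred EdgeSet ℓ} where

    spans-reverse : ∀ {xs} (p : Walk H s t) →
                    Spans 𝒞 xs (edges H (reverse p)) → Spans 𝒞 xs (edges H p)
    spans-reverse p = spans-mono inj₁ (inj₂ ∘ ∈-resp-↭ (edges-reverse p))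

    spans-reflect : ∀ {xs} (q : Walk H s t) (r : Walk H t s) →
      Spans 𝒞 xs (edges H (reverse r)) ⊎ Spans 𝒞 xs (edges H (reverse q)) →
      Spans 𝒞 xs (edges H q) ⊎ Spans 𝒞 xs (edges H r)
    spans-reflect q r = swap ∘ ⊎-map (spans-reverse r) (spans-reverse q)

    -- The member `C` and its arcs are quantified inside, since uncrossing replaces the member
    -- during the induction. The walk stays in `G`, so that its ears remain paths to which
    -- uncrossability applies.
    Reroutable : Walk G s t → Set ℓ
    Reroutable {s} {t} a = ∀ {C} → 𝒞 C → (q : Walk H s t) (r : Walk H t s) → Arcs C q r →
      Spans 𝒞 (edges G a) (edges H q) ⊎ Spans 𝒞 (edges G a) (edges H r)

    -- Moving `s` across `e` passes `e` to the other arc, which does no harm: `e` is also an edge of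
    -- the rerouted walk.
    shift-along : (j : Joins G e s y) (a : Walk G y t) → Reroutable a → 𝒞 C →
      (q : Walk H s t) (r : Walk H t s) → Arcs C q r → e ∈ edges H q →
      Spans 𝒞 (e ∷ edges G a) (edges H q) ⊎ Spans 𝒞 (e ∷ edges G a) (edges H r)
    shift-along {e} {y = y} {t} {C} j a reroute-a C∈𝒞 q r A e∈q
      with first-edge q (arc-simple A) (joins-underlying G j) e∈q
    ... | k , q′ , refl with y ≟ t
    -- Here `q` is the single edge `e`, so `C` itself lies in `e` together with `r`.
    ...   | yes refl with refl ← simple-closed q′ (Unique-++ʳ [ _ ] (arc-simple A)) =
            inj₂ (C , C∈𝒞 , ⊎-map (λ { (here e≡) → here e≡ ; (there ()) }) id ∘ A .cover⁻)
    ...   | no y≢t with reroute-a C∈𝒞 q′ (r ⟫ cons e k nil) (regroup (cons e k nil) q′ y≢t A)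
    ...     | inj₁ S = inj₁ (spans-mono (inj₁ ∘ there) (inj₂ ∘ there) S)
    ...     | inj₂ S = inj₂ (spans-mono (inj₁ ∘ there) step S)
      where
      step : ∀ {f} → f ∈ edges H (r ⟫ cons e k nil) → f ∈ e ∷ edges G a ⊎ f ∈ edges H r
      step f∈ with ∈-++⁻ (edges H r) (subst (_ ∈_) (edges-⟫ r _) f∈)
      ... | inj₁ f∈r         = inj₂ f∈r
      ... | inj₂ (here refl) = inj₁ (here refl)

    module _ (uncross : Uncrossable G 𝒞) {C₁ : EdgeSet} (C₁∈𝒞 : 𝒞 C₁) where

      -- In the uncrossing step `C` is the first cycle and `C₁` the second, so the ear is the path
      -- taken from the second cycle. That `s` and `y` lie on `C` follows from the arcs of `C`
      -- between them.
      record Ear (C : EdgeSet) (p : Walk G s y) : Set where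
        field
          open-ended : s ≢ y
          simple     : Simple p
          within     : e ∈ edges G p → e ∈ₛ C₁
          interior   : x ∈ vertices G p → _LiesOn_ G x C → x ≡ s ⊎ x ≡ y
          avoids     : e ∈ edges G p → e ∉ₛ C

      open Ear

      -- By `arc-dichotomy`, the path returned in `C` has the edges of `q` or of `r`. In the second
      -- case the new member is kept with its arcs, so that the induction can continue with it.
      uncross-ear : 𝒞 C → (p : Walk G s y) → Ear C p → (q : Walk H s y) (r : Walk H y s) → Arcs C q r →
        Spans 𝒞 (edges G p) (edges H q) ⊎ (∃[ C′ ] 𝒞 C′ × Arcs C′ (forget p) r)
      uncross-ear {C} {s} {y} C∈𝒞 p E q r A
        with uncross C C₁ C∈𝒞 C₁∈𝒞 s y (edgeSet G p) (E .open-ended)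
               (inj₁ (p , E .simple , refl) , (λ e∈ → E .within (edgeSet⁻ p e∈)))
               (liesOn-arc A (∈-++⁺ˡ (start∈departures (A .distinct) q)) ,
                liesOn-arc A (∈-++⁺ʳ _ (start∈departures (A .distinct ∘ sym) r)) ,
                (λ { x (e , e∈p , x∈e) → E .interior (end∈vertices p (edgeSet⁻ p e∈p) x∈e) }) ,
                λ e e∈p → E .avoids (edgeSet⁻ p e∈p))
      ... | P′ , (path , P′⊆C) , belongs , _ with belongs⁻ {G = G} belongs | undirectedPath path
      ...   | C′ , C′∈𝒞 , C′⊆ , C′⊇ | p′ , p′! , p′⊆P′ , P′⊆p′
        with arc-dichotomy p′ p′! (λ e∈ → P′⊆C (p′⊆P′ e∈)) q r A
      ...     | inj₁ p′≐q = inj₁ (C′ , C′∈𝒞 ,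
                  swap ∘ ⊎-map (proj₁ (p′≐q _) ∘ P′⊆p′) (edgeSet⁻ p) ∘ C′⊆)
      ...     | inj₂ p′≐r = inj₂ (C′ , C′∈𝒞 ,
                  replace-arc (forget p) A
                    (subst Unique (sym (vertices-forget p)) (E .simple))
                    (λ x∈ → E .interior (subst (_ ∈_) (vertices-forget p) x∈))
                    (swap ∘ ⊎-map (proj₁ (p′≐r _) ∘ P′⊆p′)
                      (λ e∈ → subst (_ ∈_) (sym (edges-forget p)) (edgeSet⁻ p e∈)) ∘ C′⊆)
                    (C′⊇ ∘ swap ∘ ⊎-map (λ e∈ → edgeSet⁺ p (subst (_ ∈_) (edges-forget p) e∈))
                      (p′⊆P′ ∘ proj₂ (p′≐r _))))

      cross-along : (p : Walk G s y) (a : Walk G y t) → Reroutable a → 𝒞 C → Ear C p →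
        (q : Walk H s t) (r : Walk H t s) → Arcs C q r → y ∈ vertices H q →
        Spans 𝒞 (edges G (p ⟫ a)) (edges H q) ⊎ Spans 𝒞 (edges G (p ⟫ a)) (edges H r)
      cross-along {s} {y} {t} p a reroute-a C∈𝒞 E q r A y∈q with splitAt q y∈q | y ≟ t
      -- The ear ends at `t`: either outcome of uncrossing is already an alternative of the claim.
      ... | _ | yes refl =
        ⊎-map (spans-mono (inj₁ ∘ p⊆) inj₂)
              (λ { (C′ , C′∈𝒞 , A′) → C′ , C′∈𝒞 ,
                   ⊎-map (λ e∈ → p⊆ (subst (_ ∈_) (edges-forget p) e∈)) id ∘ A′ .cover⁻ })
              (uncross-ear C∈𝒞 p E q r A)
        where
        p⊆ : ∀ {e} → e ∈ edges G p → e ∈ edges G (p ⟫ a)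
        p⊆ e∈p = subst (_ ∈_) (sym (edges-⟫ p a)) (∈-++⁺ˡ e∈p)
      ... | q₁ , q₂ , refl | no y≢t
        with uncross-ear C∈𝒞 p E q₁ (q₂ ⟫ r)
               -- Arcs of `C` between `s` and `y`: first the dividing vertex `s` moves to `y`, then
               -- `t` moves to `s`.
               (regroup r q₁ (E .open-ended) (rotate (regroup q₁ q₂ y≢t A)))
      ...   | inj₁ S = inj₁ (spans-mono
                (λ e∈p → inj₁ (subst (_ ∈_) (sym (edges-⟫ p a)) (∈-++⁺ˡ e∈p)))
                (λ e∈q₁ → inj₂ (subst (_ ∈_) (sym (edges-⟫ q₁ q₂)) (∈-++⁺ˡ e∈q₁))) S)
      -- The new member is the closed walk `p`, `q₂`, `r`. Divided at `y` and `t`, its arcs are `q₂`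
      -- and `r` followed by `p`, and `p` belongs to the rerouted walk anyway.
      ...   | inj₂ (C′ , C′∈𝒞 , A′) =
        ⊎-map (spans-mono a⊆ (λ e∈q₂ → inj₂ (subst (_ ∈_) (sym (edges-⟫ q₁ q₂)) (∈-++⁺ʳ (edges H q₁) e∈q₂))))
              (spans-mono a⊆ r⟫p⊆)
              (reroute-a C′∈𝒞 q₂ (r ⟫ forget p)
                (regroup (forget p) q₂ y≢t (rotate (regroup q₂ r (A .distinct ∘ sym) (rotate A′)))))
        where
        a⊆ : ∀ {e} {ys} → e ∈ edges G a → e ∈ edges G (p ⟫ a) ⊎ e ∈ ys
        a⊆ e∈a = inj₁ (subst (_ ∈_) (sym (edges-⟫ p a)) (∈-++⁺ʳ (edges G p) e∈a))
        r⟫p⊆ : ∀ {e} → e ∈ edges H (r ⟫ forget p) → e ∈ edges G (p ⟫ a) ⊎ e ∈ edges H r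
        r⟫p⊆ e∈ with ∈-++⁻ (edges H r) (subst (_ ∈_) (edges-⟫ r (forget p)) e∈)
        ... | inj₁ e∈r = inj₂ e∈r
        ... | inj₂ e∈p = inj₁ (subst (_ ∈_) (sym (edges-⟫ p a))
                           (∈-++⁺ˡ (subst (_ ∈_) (edges-forget p) e∈p)))

      -- The bound `n` carries the induction, since the rest behind an ear comes from cutting a walk
      -- and is not structurally smaller.
      reroute : ∀ n (a : Walk G s t) → length (edges G a) ≤ n → Simple a →
                (∀ {e} → e ∈ edges G a → e ∈ₛ C₁) → Reroutable a
      reroute _ nil _ _ _ _ _ _ A = contradiction refl (A .distinct)
      reroute {s} {t} (suc n) (cons {v = s′} e j a) (s≤s a≤n) a!@(_ ∷ a!′) a⊆C₁ {C} C∈𝒞 q r A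
        with e ∈? C
      ... | yes e∈C = [ shift-along j a reroute-a C∈𝒞 q r A
                      , spans-reflect q r ∘ shift-along j a reroute-a C∈𝒞 (reverse r) (reverse q) (reflect A)
                          ∘ ∈-resp-↭ (↭-sym (edges-reverse r))
                      ]′ (A .cover⁻ e∈C)
        where
        reroute-a : Reroutable a
        reroute-a = reroute n a a≤n a!′ (a⊆C₁ ∘ there)
      ... | no e∉C
        -- The search starts behind `e`, as `s` itself is on `C`; it succeeds because `t` is on `C`.
        with firstHit C a (liesOn-arc A (∈-++⁺ʳ (departures H q) (start∈departures (A .distinct ∘ sym) r)))
      ...   | y , p , a′ , refl , y∈C , off =
        [ cross-along ear a′ reroute-a′ C∈𝒞 E q r A
        , spans-reflect q r ∘ cross-along ear a′ reroute-a′ C∈𝒞 E (reverse r) (reverse q) (reflect A)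
            ∘ ∈-resp-↭ (↭-sym (vertices-reverse r))
        ]′ (on-arc A y∈C)
        where
        ear : Walk G s y
        ear = cons e j p
        s∉p : s ∉ vertices G (p ⟫ a′)
        s∉p = Unique[x∷xs]⇒x∉xs a!
        reroute-a′ : Reroutable a′
        reroute-a′ = reroute n a′
          (≤-trans (≤-trans (m≤n+m _ (length (edges G p)))
                     (≤-reflexive (sym (trans (cong length (edges-⟫ p a′)) (length-++ (edges G p)))))) a≤n)
          (simple-⟫ʳ p a′ a!′)
          (λ e∈ → a⊆C₁ (there (subst (_ ∈_) (sym (edges-⟫ p a′)) (∈-++⁺ʳ (edges G p) e∈))))
        E : Ear C ear
        E .open-ended refl = s∉p (subst (_ ∈_) (sym (vertices-⟫ p a′)) (∈-++⁺ʳ _ (start∈ a′)))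
        E .simple = simple-⟫ˡ ear a′ a!
        E .within {f} e∈ = a⊆C₁ (subst (f ∈_) (sym (edges-⟫ ear a′)) (∈-++⁺ˡ e∈))
        E .interior (here refl) _ = inj₁ refl
        E .interior (there x∈p) x∈C with vertex-cases p x∈p
        ... | inj₁ x∈dep = contradiction x∈C (off x∈dep)
        ... | inj₂ x≡y   = inj₂ x≡y
        -- The first edge misses `C` by the case distinction; each later one has an end before `y`,
        -- which is off `C`.
        E .avoids (here refl) = e∉C
        E .avoids (there f∈p) f∈C with edge-departure p f∈p
        ... | x , x∈p , x∈f = off x∈p (_ , f∈C , x∈f)

  -- Cutting a cycle at two of its vertices.

  edges-⟫-comm : (p : Walk G u v) (q : Walk G v u) → edges G (p ⟫ q) ↭ edges G (q ⟫ p)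
  edges-⟫-comm p q = begin
    edges G (p ⟫ q)        ≡⟨ edges-⟫ p q ⟩
    edges G p ++ edges G q ↭⟨ ++-comm (edges G p) _ ⟩
    edges G q ++ edges G p ≡⟨ edges-⟫ q p ⟨
    edges G (q ⟫ p)        ∎
    where open PermutationReasoning

  departures-⟫-comm : (p : Walk G u v) (q : Walk G v u) →
                      departures G (p ⟫ q) ↭ departures G (q ⟫ p)
  departures-⟫-comm p q = begin
    departures G (p ⟫ q)             ≡⟨ departures-⟫ p q ⟩
    departures G p ++ departures G q ↭⟨ ++-comm (departures G p) _ ⟩
    departures G q ++ departures G p ≡⟨ departures-⟫ q p ⟨
    departures G (q ⟫ p)             ∎
    where open PermutationReasoning

  -- The closed walk is rotated to start at `v` and then cut at `w`. Edge-disjointness is returned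
  -- separately: distinct departures do not exclude going back and forth along one undirected edge.
  bisect : IsCycle G C → v ≢ w → _LiesOn_ G v C → _LiesOn_ G w C →
           ∃[ a ] ∃[ b ] Arcs {G} {v} {w} C a b × Disjoint (edges G a) (edges G b)
  bisect {v = v} {w} (z , p , _ , departures! , edges! , refl) v≢w (e , e∈C , v∈e) (f , f∈C , w∈f)
    with splitAt p (end∈vertices p (edgeSet⁻ p e∈C) v∈e)
  ... | p₁ , p₂ , refl
    with splitAt (p₂ ⟫ p₁)
           (end∈vertices (p₂ ⟫ p₁) (∈-resp-↭ (edges-⟫-comm p₁ p₂) (edgeSet⁻ (p₁ ⟫ p₂) f∈C)) w∈f)
  ...   | a , b , loop≡ = a , b , arcs , Unique-++-disjoint (edges G a) (Unique-↭ edges↭ edges!)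
    where
    edges↭ : edges G (p₁ ⟫ p₂) ↭ edges G a ++ edges G b
    edges↭ = ↭-trans (edges-⟫-comm p₁ p₂)
                     (↭-reflexive (trans (cong (edges G) loop≡) (edges-⟫ a b)))
    departures↭ : departures G (p₁ ⟫ p₂) ↭ departures G a ++ departures G b
    departures↭ = ↭-trans (departures-⟫-comm p₁ p₂)
                          (↭-reflexive (trans (cong (departures G) loop≡) (departures-⟫ a b)))
    arcs : Arcs (edgeSet G (p₁ ⟫ p₂)) a b
    arcs .distinct  = v≢w
    arcs .unique    = Unique-↭ departures↭ departures!
    arcs .cover⁻ e∈ = ∈-++⁻ (edges G a) (∈-resp-↭ edges↭ (edgeSet⁻ (p₁ ⟫ p₂) e∈))
    arcs .cover⁺ e∈ = edgeSet⁺ (p₁ ⟫ p₂)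
      (∈-resp-↭ (↭-sym edges↭) ([ ∈-++⁺ˡ , ∈-++⁺ʳ (edges G a) ]′ e∈))

  arc-isPath : {a : Walk G s t} {b : Walk G t s} → Arcs C a b → IsPath G s t (edgeSet G a)
  arc-isPath {a = a} A = a , arc-simple A , refl

  arc⊆ : {a : Walk G s t} {b : Walk G t s} → Arcs C a b → edgeSet G a ⊆ C
  arc⊆ {a = a} A e∈a = A .cover⁺ (inj₁ (edgeSet⁻ a e∈a))

  opposite⊆ : {a : Walk G s t} {b : Walk G t s} → Arcs C a b → Disjoint (edges G a) (edges G b) →
              e ∈ edges G b → e ∈ₛ C ─ₛ edgeSet G a
  opposite⊆ {a = a} A a#b e∈b =
    x∈p∧x∉q⇒x∈p─q (A .cover⁺ (inj₂ e∈b)) λ e∈a → a#b (edgeSet⁻ a e∈a , e∈b)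

  -- Matching the arcs of the two cycles.

  module _ {ℓ} {𝒞 : Pred EdgeSet ℓ} where

    arc-spans : Uncrossable G 𝒞 → ∀ {C₁ C₂} → 𝒞 C₁ → 𝒞 C₂ →
      {a : Walk G s t} {b : Walk G t s} → Arcs C₁ a b →
      (q : Walk G s t) (r : Walk G t s) → Arcs C₂ q r →
      Spans 𝒞 (edges G a) (edges G q) ⊎ Spans 𝒞 (edges G a) (edges G r)
    arc-spans uncross C₁∈𝒞 C₂∈𝒞 {a} A q r B =
      ⊎-map (spans-mono inj₁ (inj₂ ∘ subst (_ ∈_) (edges-forget q)))
            (spans-mono inj₁ (inj₂ ∘ subst (_ ∈_) (edges-forget r)))
            (reroute uncross C₁∈𝒞 (length (edges G a)) a ≤-refl (arc-simple A) (λ e∈a → A .cover⁺ (inj₁ e∈a))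
              C₂∈𝒞 (forget q) (forget r) (arcs-forget q r B))

    complementary-spans : ∀ {C₁ C₂ P₁ P₂ xs₁ ys₁ xs₂ ys₂} →
      (∀ {e} → e ∈ xs₁ → e ∈ₛ P₁) → (∀ {e} → e ∈ ys₁ → e ∈ₛ C₁ ─ₛ P₁) →
      (∀ {e} → e ∈ xs₂ → e ∈ₛ P₂) → (∀ {e} → e ∈ ys₂ → e ∈ₛ C₂ ─ₛ P₂) →
      Spans 𝒞 xs₁ xs₂ → Spans 𝒞 ys₁ ys₂ →
      ContainsMember G (_⊕_ G P₁ P₂) 𝒞 × ContainsMember G (_⊕_ G (C₁ ─ₛ P₁) (C₂ ─ₛ P₂)) 𝒞
    complementary-spans f₁ g₁ f₂ g₂ (D , D∈𝒞 , D⊆) (D′ , D′∈𝒞 , D′⊆) =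
      containsMember⁺ {G = G} (D , D∈𝒞 , ⊎-map f₁ f₂ ∘ D⊆) ,
      containsMember⁺ {G = G} (D′ , D′∈𝒞 , ⊎-map g₁ g₂ ∘ D′⊆)

theorem4p4 : ∀ {ℓ} (G : Graph) (𝒞 : Pred (Graph.EdgeSet G) ℓ) →
    CyclesOnly G 𝒞 → Uncrossable G 𝒞 → StronglyUncrossable G 𝒞
theorem4p4 G 𝒞 cycles uncross C₁ C₂ C₁∈𝒞 C₂∈𝒞 v w v≢w v∈C₁ v∈C₂ w∈C₁ w∈C₂
  with bisect {G} (cycles C₁∈𝒞) v≢w v∈C₁ w∈C₁ | bisect {G} (cycles C₂∈𝒞) v≢w v∈C₂ w∈C₂
... | a₁ , b₁ , A₁ , a₁#b₁ | a₂ , b₂ , A₂ , a₂#b₂ =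
  choose (arc-spans uncross C₁∈𝒞 C₂∈𝒞 A₁ a₂ b₂ A₂)
         -- The arcs `b₁` and `b₂` run from `w` to `v`, so both cycles are rotated when one of them
         -- seeks a partner.
         (arc-spans uncross C₁∈𝒞 C₂∈𝒞 (rotate A₁) b₂ a₂ (rotate A₂))
         (arc-spans uncross C₂∈𝒞 C₁∈𝒞 A₂ a₁ b₁ A₁)
         (arc-spans uncross C₂∈𝒞 C₁∈𝒞 (rotate A₂) b₁ a₁ (rotate A₁))
  where
  S = Spans 𝒞
  E = λ {x y} → edges G {x} {y}
  Goal = ∃[ P₁ ] ∃[ P₂ ] PathIn G C₁ v w P₁ × PathIn G C₂ v w P₂
           × ContainsMember G (_⊕_ G P₁ P₂) 𝒞
           × ContainsMember G (_⊕_ G (C₁ ─ₛ P₁) (C₂ ─ₛ P₂)) 𝒞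

  parallel : S (E a₁) (E a₂) → S (E b₁) (E b₂) → Goal
  parallel aa bb = edgeSet G a₁ , edgeSet G a₂ ,
    (inj₁ (arc-isPath A₁) , arc⊆ A₁) , (inj₁ (arc-isPath A₂) , arc⊆ A₂) ,
    complementary-spans {G} (edgeSet⁺ a₁) (opposite⊆ A₁ a₁#b₁) (edgeSet⁺ a₂) (opposite⊆ A₂ a₂#b₂) aa bb

  crossed : S (E a₁) (E b₂) → S (E b₁) (E a₂) → Goal
  crossed ab ba = edgeSet G a₁ , edgeSet G b₂ ,
    (inj₁ (arc-isPath A₁) , arc⊆ A₁) , (inj₂ (arc-isPath (rotate A₂)) , arc⊆ (rotate A₂)) ,
    complementary-spans {G} (edgeSet⁺ a₁) (opposite⊆ A₁ a₁#b₁)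
      (edgeSet⁺ b₂) (opposite⊆ (rotate A₂) (a₂#b₂ ∘ ×-swap)) ab ba

  -- If `a₁` and `b₁` have different partners, these form a matching. Otherwise they share one, and
  -- whichever partner the remaining arc of `C₂` has completes a matching with it.
  choose : S (E a₁) (E a₂) ⊎ S (E a₁) (E b₂) → S (E b₁) (E b₂) ⊎ S (E b₁) (E a₂) →
           S (E a₂) (E a₁) ⊎ S (E a₂) (E b₁) → S (E b₂) (E b₁) ⊎ S (E b₂) (E a₁) → Goal
  choose (inj₁ aa) (inj₁ bb) _ _ = parallel aa bb
  choose (inj₂ ab) (inj₂ ba) _ _ = crossed ab ba
  choose (inj₁ aa) (inj₂ ba) _ (inj₁ bb) = parallel aa (spans-sym bb)
  choose (inj₁ aa) (inj₂ ba) _ (inj₂ ab) = crossed (spans-sym ab) ba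
  choose (inj₂ ab) (inj₁ bb) (inj₁ aa) _ = parallel (spans-sym aa) bb
  choose (inj₂ ab) (inj₁ bb) (inj₂ ba) _ = crossed ab (spans-sym ba)
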